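{- Let $\mathtt{hrm}$, $\mathtt{hrm\_en}$, $\mathtt{sy}$, $\mathtt{des\_hrm\_en}$ be distinct propositional variables. Then \[\bigl\{\ \mathtt{hrm\_en}\to\mathtt{hrm},\ \ \mathtt{sy}\to\mathtt{hrm\_en},\ \ \mathcal{O}(\neg\mathtt{hrm}/\top),\ \ \mathcal{O}(\mathtt{sy}/\mathtt{des\_hrm\_en})\ \bigr\}\not\vdash_{\mathsf{bMDL}}\bot .\]
   Context: Formulae are built from propositional variables and $\bot$ using the classical connectives $\neg,\land,\lor,\to$, a unary modality $\Box$ and a binary modality $\mathcal{O}(\cdot/\cdot)$; $\top$ abbreviates $\bot\to\bot$. The logic $\mathsf{bMDL}$ is given by the Hilbert system for modal logic $\mathsf{S4}$ (classical propositional tautologies over the full language, $\Box(\varphi\to\psi)\to(\Box\varphi\to\Box\psi)$, $\Box\varphi\to\varphi$, $\Box\varphi\to\Box\Box\varphi$, modus ponens, necessitation: from $\varphi$ infer $\Box\varphi$) together with the axiom schemata (1) $(\Box(\varphi\to\psi)\land\mathcal{O}(\varphi/\theta))\to\mathcal{O}(\psi/\theta)$; (2) $\Box(\psi\to\neg\varphi)\to\neg(\mathcal{O}(\varphi/\theta)\land\mathcal{O}(\psi/\theta))$; (3) $(\Box((\psi\to\theta)\land(\theta\to\psi))\land\mathcal{O}(\varphi/\psi))\to\mathcal{O}(\varphi/\theta)$. $\mathcal{A}\vdash_{\mathsf{bMDL}}\varphi$ means that $\varphi$ is derivable in this Hilbert system from the (global) assumptions $\mathcal{A}$, i.e. elements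 of $\mathcal{A}$ may be used like axioms, and necessitation may be applied to anything derived. -}

module Defs where

open import Data.Bool.Base as Bool using (Bool; true; false; not)
open import Data.Nat.Base using (ℕ)
open import Level using (0ℓ)
open import Relation.Binary.PropositionalEquality.Core using (_≡_)
open import Relation.Unary using (Pred; _∈_)

infix  8 ∼_ □_
infixr 7 _∧_
infixr 6 _∨_
infixr 5 _⇒_
infix  3 _⊢_

-- Object-level negation is written ∼ and implication ⇒, since ¬ and → denote
-- those of the metalanguage.
data Formula : Set where
  var     : ℕ → Formula
  ⊥       : Formula
  ∼_      : Formula → Formula
  _∧_     : Formula → Formula → Formula
  _∨_     : Formula → Formula → Formula
  _⇒_     : Formula → Formula → Formula
  □_      : Formula → Formula
  𝒪⟨_/_⟩  : Formula → Formula → Formula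

⊤ : Formula
⊤ = ⊥ ⇒ ⊥

-- Variables and modalised formulae (□ φ and 𝒪⟨ φ / ψ ⟩) are the propositional
-- atoms: v is consulted on these only, and may assign them arbitrary truth values.
eval : (Formula → Bool) → Formula → Bool
eval v (var x)        = v (var x)
eval v ⊥              = false
eval v (∼ φ)          = not (eval v φ)
eval v (φ ∧ ψ)        = eval v φ Bool.∧ eval v ψ
eval v (φ ∨ ψ)        = eval v φ Bool.∨ eval v ψ
eval v (φ ⇒ ψ)        = not (eval v φ) Bool.∨ eval v ψ
eval v (□ φ)          = v (□ φ)
eval v 𝒪⟨ φ / ψ ⟩     = v 𝒪⟨ φ / ψ ⟩

-- Classical tautologies over the full modal language, i.e. substitution
-- instances of classical propositional tautologies.
Tautology : Pred Formula 0ℓ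
Tautology φ = ∀ v → eval v φ ≡ true

-- Assumptions are global: nec applies to every derivable formula, including
-- those whose derivation uses assumptions.
data _⊢_ (𝒜 : Pred Formula 0ℓ) : Pred Formula 0ℓ where
  assumption : ∀ {φ} → φ ∈ 𝒜 → 𝒜 ⊢ φ
  tautology  : ∀ {φ} → φ ∈ Tautology → 𝒜 ⊢ φ
  axiom-K    : ∀ φ ψ → 𝒜 ⊢ □ (φ ⇒ ψ) ⇒ □ φ ⇒ □ ψ
  axiom-T    : ∀ φ → 𝒜 ⊢ □ φ ⇒ φ
  axiom-4    : ∀ φ → 𝒜 ⊢ □ φ ⇒ □ □ φ
  𝒪-mono     : ∀ φ ψ θ → 𝒜 ⊢ (□ (φ ⇒ ψ) ∧ 𝒪⟨ φ / θ ⟩) ⇒ 𝒪⟨ ψ / θ ⟩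
  𝒪-consist  : ∀ φ ψ θ → 𝒜 ⊢ □ (ψ ⇒ ∼ φ) ⇒ ∼ (𝒪⟨ φ / θ ⟩ ∧ 𝒪⟨ ψ / θ ⟩)
  𝒪-cong     : ∀ φ ψ θ →
               𝒜 ⊢ (□ ((ψ ⇒ θ) ∧ (θ ⇒ ψ)) ∧ 𝒪⟨ φ / ψ ⟩) ⇒ 𝒪⟨ φ / θ ⟩
  mp         : ∀ {φ ψ} → 𝒜 ⊢ φ ⇒ ψ → 𝒜 ⊢ φ → 𝒜 ⊢ ψ
  nec        : ∀ {φ} → 𝒜 ⊢ φ → 𝒜 ⊢ □ φ

{-# OPTIONS --safe #-}
-- Soundness for an S5 model with two mutually accessible worlds, "true", where
-- every variable holds, and "false", where none does.  Each condition θ selects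
-- a best world, "false" if θ holds there and "true" otherwise, and 𝒪⟨ φ / θ ⟩
-- says that φ holds at the selected world.  Thus ⊤ selects "false", where hrm
-- fails, while des-hrm-en selects "true", where sy holds.
module Submission where

open import Defs
open import Data.Bool.Base as Bool using (Bool; true; false; not; T)
open import Data.Bool.Properties using (T-∧; T-≡)
open import Data.Nat.Base using (ℕ)
open import Data.List.Base using (_∷_; [])
open import Data.List.Relation.Unary.Unique.Propositional using (Unique)
open import Data.Product.Base using (_×_; _,_; proj₁; proj₂)
open import Data.Sum.Base using (inj₁; inj₂)
open import Data.Unit.Base using (tt)
open import Function.Bundles using (Equivalence)
open import Level using (0ℓ)
open import Relation.Binary.PropositionalEquality
  using (_≡_; refl; sym; trans; cong; cong₂; subst)
open import Relation.Nullary.Negation.Core using (¬_)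
open import Relation.Unary using (Pred; _∈_; ｛_｝; _∪_)

World : Set
World = Bool

⟦_⟧ : Formula → World → Bool
-- A condition true at neither world still gets a best world, namely `true`, so `𝒪-consist` holds
-- even for unsatisfiable conditions.
best : Formula → World

⟦ var x ⟧ w       = w
⟦ ⊥ ⟧ w           = false
⟦ ∼ φ ⟧ w         = not (⟦ φ ⟧ w)
⟦ φ ∧ ψ ⟧ w       = ⟦ φ ⟧ w Bool.∧ ⟦ ψ ⟧ w
⟦ φ ∨ ψ ⟧ w       = ⟦ φ ⟧ w Bool.∨ ⟦ ψ ⟧ w
⟦ φ ⇒ ψ ⟧ w       = not (⟦ φ ⟧ w) Bool.∨ ⟦ ψ ⟧ w
⟦ □ φ ⟧ w         = ⟦ φ ⟧ true Bool.∧ ⟦ φ ⟧ false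
⟦ 𝒪⟨ φ / θ ⟩ ⟧ w  = ⟦ φ ⟧ (best θ)

best θ = not (⟦ θ ⟧ false)

infix 4 _⊩_

_⊩_ : World → Formula → Set
w ⊩ φ = T (⟦ φ ⟧ w)

Valid : Pred Formula 0ℓ
Valid φ = ∀ w → w ⊩ φ

-- Truth at `w` is itself a valuation of the propositional atoms, modalised formulae included, so a
-- tautology can be instantiated at it.
eval-⟦⟧ : ∀ w φ → eval (λ ψ → ⟦ ψ ⟧ w) φ ≡ ⟦ φ ⟧ w
eval-⟦⟧ w (var x)      = refl
eval-⟦⟧ w ⊥            = refl
eval-⟦⟧ w (∼ φ)        = cong not (eval-⟦⟧ w φ)
eval-⟦⟧ w (φ ∧ ψ)      = cong₂ Bool._∧_ (eval-⟦⟧ w φ) (eval-⟦⟧ w ψ)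
eval-⟦⟧ w (φ ∨ ψ)      = cong₂ Bool._∨_ (eval-⟦⟧ w φ) (eval-⟦⟧ w ψ)
eval-⟦⟧ w (φ ⇒ ψ)      =
  cong₂ (λ a b → not a Bool.∨ b) (eval-⟦⟧ w φ) (eval-⟦⟧ w ψ)
eval-⟦⟧ w (□ φ)        = refl
eval-⟦⟧ w 𝒪⟨ φ / θ ⟩   = refl

tautology-valid : ∀ {φ} → Tautology φ → Valid φ
tautology-valid {φ} taut w =
  Equivalence.from T-≡ (trans (sym (eval-⟦⟧ w φ)) (taut λ ψ → ⟦ ψ ⟧ w))

∼-intro : ∀ {w} φ → ¬ (w ⊩ φ) → w ⊩ ∼ φ
∼-intro {w} φ ¬p with ⟦ φ ⟧ w
... | true  = ¬p tt
... | false = tt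

∼-elim : ∀ {w} φ → w ⊩ ∼ φ → ¬ (w ⊩ φ)
∼-elim {w} φ with ⟦ φ ⟧ w
... | true  = λ ()
... | false = λ _ ()

∧-elim : ∀ {w} φ ψ → w ⊩ φ ∧ ψ → w ⊩ φ × w ⊩ ψ
∧-elim φ ψ = Equivalence.to T-∧

⇒-intro : ∀ {w} φ ψ → (w ⊩ φ → w ⊩ ψ) → w ⊩ φ ⇒ ψ
⇒-intro {w} φ ψ f with ⟦ φ ⟧ w
... | true  = f tt
... | false = tt

⇒-elim : ∀ {w} φ ψ → w ⊩ φ ⇒ ψ → w ⊩ φ → w ⊩ ψ
⇒-elim {w} φ ψ with ⟦ φ ⟧ w
... | true  = λ p _ → p
... | false = λ _ ()

-- An equality of truth values, unlike a pair of implications, can be carried through `best`.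
⇔-elim : ∀ {w} φ ψ → w ⊩ (φ ⇒ ψ) ∧ (ψ ⇒ φ) → ⟦ φ ⟧ w ≡ ⟦ ψ ⟧ w
⇔-elim {w} φ ψ p with ⟦ φ ⟧ w | ⟦ ψ ⟧ w
... | true  | true  = refl
... | false | false = refl

□-intro : ∀ {w} φ → Valid φ → w ⊩ □ φ
□-intro φ valid = Equivalence.from T-∧ (valid true , valid false)

□-elim : ∀ {w} φ → w ⊩ □ φ → Valid φ
□-elim φ p true  = proj₁ (Equivalence.to T-∧ p)
□-elim φ p false = proj₂ (Equivalence.to T-∧ p)

-- Induction on the derivation. Truth at every world, rather than at one, is what `nec` preserves;
-- hence the global assumptions must be valid too.
sound : ∀ {𝒜 φ} → (∀ {α} → α ∈ 𝒜 → Valid α) → 𝒜 ⊢ φ → Valid φ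
sound valid (assumption α∈𝒜) = valid α∈𝒜
sound valid (tautology {φ} taut) = tautology-valid {φ} taut
sound valid (axiom-K φ ψ) w =
  ⇒-intro {w} (□ (φ ⇒ ψ)) (□ φ ⇒ □ ψ) λ p →
  ⇒-intro {w} (□ φ) (□ ψ) λ q →
  □-intro {w} ψ λ u → ⇒-elim φ ψ (□-elim {w} (φ ⇒ ψ) p u) (□-elim {w} φ q u)
sound valid (axiom-T φ) w = ⇒-intro {w} (□ φ) φ λ p → □-elim {w} φ p w
sound valid (axiom-4 φ) w =
  -- The value of `□ φ` is the same at both worlds, so `p` serves at each.
  ⇒-intro {w} (□ φ) (□ □ φ) λ p → □-intro {w} (□ φ) λ _ → p
sound valid (𝒪-mono φ ψ θ) w =
  ⇒-intro {w} (□ (φ ⇒ ψ) ∧ 𝒪⟨ φ / θ ⟩) 𝒪⟨ ψ / θ ⟩ λ p →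
  let q , r = ∧-elim {w} (□ (φ ⇒ ψ)) 𝒪⟨ φ / θ ⟩ p
  in ⇒-elim φ ψ (□-elim {w} (φ ⇒ ψ) q (best θ)) r
sound valid (𝒪-consist φ ψ θ) w =
  ⇒-intro {w} (□ (ψ ⇒ ∼ φ)) (∼ (𝒪⟨ φ / θ ⟩ ∧ 𝒪⟨ ψ / θ ⟩)) λ p →
  ∼-intro {w} (𝒪⟨ φ / θ ⟩ ∧ 𝒪⟨ ψ / θ ⟩) λ q →
  let r , s = ∧-elim {w} 𝒪⟨ φ / θ ⟩ 𝒪⟨ ψ / θ ⟩ q
  -- Both obligations concern the single world `best θ`, where the boxed implication makes them
  -- clash.
  in ∼-elim φ (⇒-elim ψ (∼ φ) (□-elim {w} (ψ ⇒ ∼ φ) p (best θ)) s) r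
sound valid (𝒪-cong φ ψ θ) w =
  ⇒-intro {w} (□ ψ⇔θ ∧ 𝒪⟨ φ / ψ ⟩) 𝒪⟨ φ / θ ⟩ λ p →
  let q , r = ∧-elim {w} (□ ψ⇔θ) 𝒪⟨ φ / ψ ⟩ p
      -- `best` inspects its condition at `false` only, so agreement there gives the same best
      -- world.
      same-at-false = ⇔-elim ψ θ (□-elim {w} ψ⇔θ q false)
  in subst (_⊩ φ) (cong not same-at-false) r
  where
  ψ⇔θ : Formula
  ψ⇔θ = (ψ ⇒ θ) ∧ (θ ⇒ ψ)
sound valid (mp {φ} {ψ} d e) w = ⇒-elim φ ψ (sound valid d w) (sound valid e w)
sound valid (nec {φ} d) w = □-intro {w} φ (sound valid d)

theorem4 : (hrm hrm-en sy des-hrm-en : ℕ) →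
    Unique (hrm ∷ hrm-en ∷ sy ∷ des-hrm-en ∷ []) →
    ¬ ( ｛ var hrm-en ⇒ var hrm ｝
    ∪ ｛ var sy ⇒ var hrm-en ｝
    ∪ ｛ 𝒪⟨ ∼ var hrm / ⊤ ⟩ ｝
    ∪ ｛ 𝒪⟨ var sy / var des-hrm-en ⟩ ｝
    ⊢ ⊥ )
theorem4 hrm hrm-en sy des-hrm-en _ d = sound valid d true
  where
  valid : ∀ {α} →
    α ∈ ｛ var hrm-en ⇒ var hrm ｝
      ∪ ｛ var sy ⇒ var hrm-en ｝
      ∪ ｛ 𝒪⟨ ∼ var hrm / ⊤ ⟩ ｝
      ∪ ｛ 𝒪⟨ var sy / var des-hrm-en ⟩ ｝ →
    Valid α
  -- All variables agree at any given world, so the identity proves both implications.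
  valid (inj₁ refl)               = λ w → ⇒-intro {w} (var hrm-en) (var hrm) λ p → p
  valid (inj₂ (inj₁ refl))        = λ w → ⇒-intro {w} (var sy) (var hrm-en) λ p → p
  -- Both obligations hold by computation: `best ⊤` is `false`, and `best (var des-hrm-en)` is
  -- `true`.
  valid (inj₂ (inj₂ (inj₁ refl))) = λ _ → tt
  valid (inj₂ (inj₂ (inj₂ refl))) = λ _ → tt
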